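{- Let $F=(F_n)_{n\ge 1}$ be the Fibonacci sequence and $M^F$ its Möbius dual. The following two statements are equivalent: (a) There are no Wall-Sun-Sun primes. (b) The numbers $M^F_n$ are squarefree for all integers $n\ge 1$ with $n\neq 6$.
   Context: $F_n$ denotes the Fibonacci numbers, $F_0=0$, $F_1=1$, $F_{n+2}=F_{n+1}+F_n$. The Möbius dual of $F$ is the sequence $M^F_n=\prod_{d\mid n}F_d^{\mu(n/d)}$ ($n\ge 1$), where $\mu$ is the Möbius function; all $M^F_n$ are integers. For a prime $p$, the entry point of $p$ in $F$ is $z_F(p)=\min\{n\ge 1: p\mid F_n\}$, which exists for every prime $p$. A Wall-Sun-Sun prime is a prime $p$ with $v_p(F_{z_F(p)})>1$, where $v_p$ is the $p$-adic valuation. -}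

module Defs where

open import Data.Bool.Base using (if_then_else_)
open import Data.Integer.Base as ℤ using (ℤ; +_; -[1+_]; ∣_∣; 0ℤ; -1ℤ)
import Data.Integer.Divisibility as ℤ
open import Data.List.Base using (map; foldr; filter; length; upTo)
open import Data.List.Extrema.Nat using (max)
open import Data.List.Relation.Unary.Unique.DecPropositional using (unique?)
open import Data.Nat.Base
  using (ℕ; zero; suc; _+_; _^_; _≤_; _<_; NonZero; >-nonZero; z<s)
open import Data.Nat.Divisibility using (_∣_; _∣?_)
open import Data.Nat.DivMod using (_/_)
open import Data.Nat.Primality using (Prime)
open import Data.Nat.Primality.Factorisation using (factorise; factors)
open import Data.Nat.Properties using (_≟_; m^n≢0; <-≤-trans; m≤m+n)
open import Data.Product.Base using (_×_; ∃-syntax)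
open import Data.Rational.Base as ℚ using (ℚ; 1ℚ)
open import Relation.Binary.PropositionalEquality.Core using (_≡_)
open import Relation.Nullary.Decidable.Core using (does)

fib : ℕ → ℕ
fib zero          = 0
fib (suc zero)    = 1
fib (suc (suc n)) = fib (suc n) + fib n

fib-nonZero : ∀ n → NonZero (fib (suc n))
fib-nonZero n = >-nonZero (0<fib n)
  where
  0<fib : ∀ n → 0 < fib (suc n)
  0<fib zero    = z<s
  0<fib (suc n) = <-≤-trans (0<fib n) (m≤m+n (fib (suc n)) (fib n))

-- `factors` lists prime factors with multiplicity, so n is squarefree exactly
-- when they are pairwise distinct.  The value at 0 is junk.
μ : ℕ → ℤ
μ zero      = 0ℤ
μ n@(suc _) =
  let ps = factors (factorise n) in
  if does (unique? _≟_ ps) then -1ℤ ℤ.^ length ps else 0ℤ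

infixr 8 _^ℤ_

_^ℤ_ : (a : ℕ) .{{_ : NonZero a}} → ℤ → ℚ
a ^ℤ (+ k)    = + (a ^ k) ℚ./ 1
a ^ℤ -[1+ k ] = (+ 1 ℚ./ (a ^ suc k)) {{m^n≢0 a (suc k)}}

-- ∏_{d ∣ n} F_d^{μ(n/d)} for n ≥ 1: the divisors d ∈ {1,…,n} are written as
-- d = suc k with k < n.  The value at 0 is junk.
möbiusDual : ℕ → ℚ
möbiusDual n =
  foldr ℚ._*_ 1ℚ
    (map (λ k → _^ℤ_ (fib (suc k)) {{fib-nonZero k}} (μ (n / suc k)))
         (filter (λ k → suc k ∣? n) (upTo n)))

record IsEntryPoint (p z : ℕ) : Set where
  field
    positive : 1 ≤ z
    divides  : p ∣ fib z
    minimal  : ∀ n → 1 ≤ n → p ∣ fib n → z ≤ n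

-- The p-adic valuation of m, for p ≥ 2 and m ≥ 1.  Bounding the exponents by m
-- loses nothing, since p ^ k ∣ m forces k < p ^ k ≤ m.
valuation : ℕ → ℕ → ℕ
valuation p m = max 0 (filter (λ k → (p ^ k) ∣? m) (upTo (suc m)))

WallSunSun : ℕ → Set
WallSunSun p = Prime p × ∃[ z ] (IsEntryPoint p z × 1 < valuation p (fib z))

Squarefree : ℤ → Set
Squarefree m = ∀ d → (d ℤ.* d) ℤ.∣ m → ∣ d ∣ ≡ 1

IsSquarefreeInteger : ℚ → Set
IsSquarefreeInteger q = ∃[ m ] (q ≡ m ℚ./ 1 × Squarefree m)

{-# OPTIONS --safe #-}

-- For t ≥ 1, t ∣ F_d holds exactly when the entry point z(t) divides d, so
-- Σ_{d∣n} μ(n/d) [t ∣ F_d] = [n = z(t)].  Writing v_p(F_d) as the number of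
-- j ≥ 1 with p^j ∣ F_d gives v_p(M_n) = #{ j ≥ 1 : z(p^j) = n }, which is
-- nonnegative, so M_n is an integer.  If p is Wall-Sun-Sun then z(p) = z(p²),
-- and p² divides M_n at n = z(p).  Otherwise, writing a = F_n and b = F_{n-1},
-- the expansion F_{kn} ≡ a (k b^{k-1} + C(k,2) a b^{k-2}) mod a³ shows by
-- induction on j that the numbers z(p^j) are distinct; the only exception is
-- z(4) = z(8) = 6.
module Submission where

open import Defs
open import Algebra.Bundles using (CommutativeMonoid)
open import Algebra.Properties.CommutativeSemigroup using (interchange)
open import Data.Bool.Base using (if_then_else_; true; false)
open import Data.Fin.Base using (toℕ)
open import Data.Fin.Properties using (toℕ<n)
open import Data.Integer.Base as ℤ using (ℤ; +_; -[1+_]; 0ℤ; 1ℤ; -1ℤ; ∣_∣)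
import Data.Integer.Divisibility as ℤ
import Data.Integer.Properties as ℤ
open import Data.List.Base using (List; []; _∷_; length; map; foldr; filter; upTo; applyUpTo)
open import Data.List.Extrema.Nat using (argmax-all; xs≤max)
open import Data.List.Membership.Propositional using (_∈_)
open import Data.List.Membership.Propositional.Properties using (∈-upTo⁺; ∈-filter⁺)
open import Data.List.Relation.Binary.Permutation.Propositional using (_↭_; ↭-sym; ↭⇒↭ₛ)
open import Data.List.Relation.Binary.Permutation.Propositional.Properties using (↭-length)
import Data.List.Relation.Binary.Permutation.Setoid.Properties as Permutation
open import Data.List.Relation.Unary.All as All using (All; []; _∷_)
open import Data.List.Relation.Unary.All.Properties using (all-filter; ¬Any⇒All¬)
open import Data.List.Relation.Unary.AllPairs using (_∷_)
open import Data.List.Relation.Unary.Unique.DecPropositional using (unique?)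
open import Data.List.Relation.Unary.Unique.Propositional using (Unique)
open import Data.List.Relation.Unary.Unique.Propositional.Properties using (Unique[x∷xs]⇒x∉xs)
open import Data.Nat.Base
open import Data.Nat.Coprimality using (Coprime; coprime-divisor)
open import Data.Nat.Divisibility
open import Data.Nat.DivMod using (_%_; _/_; m≡m%n+[m/n]*n; m%n<n; m*n/n≡m)
open import Data.Nat.ListAction using (product)
open import Data.Nat.ListAction.Properties using (∈⇒∣product)
open import Data.Nat.Primality
open import Data.Nat.Primality.Factorisation
open import Data.Nat.Properties
open import Data.Nat.Tactic.RingSolver using (solve-∀)
open import Data.Product.Base using (_×_; ∃-syntax; _,_; proj₁; proj₂)
open import Data.Rational.Base as ℚ using (ℚ; 1ℚ)
open import Data.Rational.Literals using (fromℤ)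
import Data.Rational.Properties as ℚ
import Data.Rational.Unnormalised.Base as ℚᵘ
import Data.Rational.Unnormalised.Properties as ℚᵘ
open import Data.Sum.Base using (_⊎_; inj₁; inj₂; [_,_]′)
open import Function.Base using (_∘_; _$_; id)
open import Function.Bundles using (_⇔_; mk⇔)
open import Level using (0ℓ)
open import Relation.Binary.Definitions using (tri<; tri≈; tri>)
open import Relation.Binary.PropositionalEquality
open import Relation.Nullary.Decidable
  using (Dec; yes; no; does; dec-true; dec-false; _×-dec_; ¬?; from-yes; from-no)
open import Relation.Nullary.Negation using (¬_; contradiction)
open import Relation.Unary using (Pred; Decidable)

open import Algebra.Properties.Semiring.Sum ℤ.+-*-semiring
  using (sum; sum-cong-≗; sum-replicate-zero; ∑-distrib-+; ∑-comm; *-distribˡ-sum)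

-- Valuations

-- The prime 2 is special because of C(p,2). In F_{pn} / F_n = p b^{p-1} + a (C(p,2) b^{p-2} + ...)
-- the tail must vanish mod p² for p to divide the quotient exactly once. For odd p both a and
-- C(p,2) supply a factor p. For p = 2 the coefficient is 1, so 4 ∣ a is needed, and the induction
-- can only start from z(8) = 6, where F_6 = 8. The powers 2 and 4 are settled by computation; M_6 =
-- 8·1 / (1·2) = 4 is the resulting exception in (b). The second obstacle is that `möbiusDual` is a
-- rational product with exponents of both signs, so integrality is itself part of (b). Valuations
-- are carried as integers attached to a fraction of naturals; once they are shown to be 0 or 1 at
-- every prime, the denominator divides the numerator and the quotient is squarefree.

k<p^k : ∀ p .{{_ : NonTrivial p}} k → k < p ^ k
k<p^k p zero    = z<s
k<p^k p (suc k) = begin-strict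
  suc k         ≤⟨ k<p^k p k ⟩
  p ^ k         <⟨ m<m*n (p ^ k) p {{m^n≢0 p k {{nonTrivial⇒nonZero p}}}} (nonTrivial⇒n>1 p) ⟩
  p ^ k * p     ≡⟨ *-comm (p ^ k) p ⟩
  p ^ suc k     ∎
  where open ≤-Reasoning

m≤n⇒p^m∣p^n : ∀ p {m n} → m ≤ n → p ^ m ∣ p ^ n
m≤n⇒p^m∣p^n p {m} {n} m≤n = divides (p ^ (n ∸ m)) $ begin
  p ^ n               ≡⟨ cong (p ^_) (m∸n+n≡m m≤n) ⟨
  p ^ (n ∸ m + m)     ≡⟨ ^-distribˡ-+-* p (n ∸ m) m ⟩
  p ^ (n ∸ m) * p ^ m ∎
  where open ≡-Reasoning

p^k∣m⇒k≤v : ∀ p .{{_ : NonTrivial p}} {k} m .{{_ : NonZero m}} → p ^ k ∣ m → k ≤ valuation p m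
p^k∣m⇒k≤v p {k} m p^k∣m =
  All.lookup (xs≤max 0 (filter (λ j → (p ^ j) ∣? m) (upTo (suc m))))
    (∈-filter⁺ (λ j → (p ^ j) ∣? m) (∈-upTo⁺ (<-≤-trans (k<p^k p k) (m≤n⇒m≤1+n (∣⇒≤ p^k∣m)))) p^k∣m)

p^v∣m : ∀ p m → p ^ valuation p m ∣ m
p^v∣m p m = argmax-all id {P = λ j → p ^ j ∣ m} (1∣ m) (all-filter (λ j → (p ^ j) ∣? m) (upTo (suc m)))

k≤v⇒p^k∣m : ∀ p {k} m → k ≤ valuation p m → p ^ k ∣ m
k≤v⇒p^k∣m p m k≤v = ∣-trans (m≤n⇒p^m∣p^n p k≤v) (p^v∣m p m)

v≡k : ∀ p .{{_ : NonTrivial p}} k m .{{_ : NonZero m}} → p ^ k ∣ m → ¬ (p ^ suc k ∣ m) → valuation p m ≡ k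
v≡k p k m p^k∣m p^1+k∤m =
  ≤-antisym (≮⇒≥ (p^1+k∤m ∘ k≤v⇒p^k∣m p m)) (p^k∣m⇒k≤v p m p^k∣m)

private
  cofactor : ∀ p .{{_ : NonTrivial p}} m .{{_ : NonZero m}} →
             ∃[ r ] (m ≡ p ^ valuation p m * r × ¬ (p ∣ r))
  cofactor p m with p^v∣m p m
  ... | d@(divides r m≡r*p^v) = r , trans m≡r*p^v (*-comm r _) , λ p∣r →
        <-irrefl refl (p^k∣m⇒k≤v p m (subst (p ^ suc (valuation p m) ∣_) (sym m≡r*p^v) (*-monoˡ-∣ _ p∣r)))

-- After the full powers of p are stripped from both factors, one more p would divide the product of
-- the cofactors, against Euclid's lemma.
v[m*n] : ∀ {p} → Prime p → ∀ m n .{{_ : NonZero m}} .{{_ : NonZero n}} →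
         valuation p (m * n) ≡ valuation p m + valuation p n
v[m*n] {p} pp m n =
    v≡k p _ (m * n) (subst (_∣ m * n) (sym (^-distribˡ-+-* p a b)) (*-pres-∣ (p^v∣m p m) (p^v∣m p n))) notMore
  where
  instance
    _ = prime⇒nonTrivial pp
    _ = prime⇒nonZero pp
    _ = m*n≢0 m n
  a = valuation p m
  b = valuation p n
  instance _ = m^n≢0 p (a + b)
  notMore : ¬ (p ^ suc (a + b) ∣ m * n)
  notMore d with cofactor p m | cofactor p n
  ... | r , m≡ , p∤r | s , n≡ , p∤s =
      [ p∤r , p∤s ]′ (euclidsLemma r s pp (*-cancelˡ-∣ (p ^ (a + b)) (subst₂ _∣_ (*-comm p (p ^ (a + b))) eq d)))
    where
    open ≡-Reasoning
    eq : m * n ≡ p ^ (a + b) * (r * s)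
    eq = begin
      m * n                         ≡⟨ cong₂ _*_ m≡ n≡ ⟩
      (p ^ a * r) * (p ^ b * s)     ≡⟨ [m*n]*[o*p]≡[m*o]*[n*p] (p ^ a) r (p ^ b) s ⟩
      (p ^ a * p ^ b) * (r * s)     ≡⟨ cong (_* (r * s)) (^-distribˡ-+-* p a b) ⟨
      p ^ (a + b) * (r * s)         ∎

v[1] : ∀ {p} → Prime p → valuation p 1 ≡ 0
v[1] {p} pp = v≡k p 0 1 ∣-refl λ d → nonTrivial⇒≢1 {p} (∣1⇒≡1 (subst (_∣ 1) (*-identityʳ p) d))
  where instance _ = prime⇒nonTrivial pp

v[m^k] : ∀ {p} → Prime p → ∀ m .{{_ : NonZero m}} k → valuation p (m ^ k) ≡ k * valuation p m
v[m^k] pp m zero    = v[1] pp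
v[m^k] pp m (suc k) = trans (v[m*n] pp m (m ^ k)) (cong (λ k → valuation _ m + k) (v[m^k] pp m k))
  where instance _ = m^n≢0 m k

-- Turns nonnegative valuations into integrality. The primes of m are removed one at a time from
-- both sides: the head prime has positive valuation in n, hence divides it, and additivity passes
-- the inequality on to the quotients.
v≤v⇒∣ : ∀ m n .{{_ : NonZero m}} .{{_ : NonZero n}} →
        (∀ p → Prime p → valuation p m ≤ valuation p n) → m ∣ n
v≤v⇒∣ m n v≤v = subst (_∣ n) (sym isFactorisation) (go ps₀ factorsPrime n
    λ p pp → subst (λ x → valuation p x ≤ valuation p n) isFactorisation (v≤v p pp))
  where
  open PrimeFactorisation (factorise m) using (isFactorisation; factorsPrime)
  ps₀ = factors (factorise m)
  go : ∀ ps → All Prime ps → ∀ n .{{_ : NonZero n}} →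
       (∀ p → Prime p → valuation p (product ps) ≤ valuation p n) → product ps ∣ n
  go []       []         n _   = 1∣ n
  go (q ∷ ps) (qq ∷ pps) n v≤v = subst (q * product ps ∣_) (sym n≡q*r)
      (*-monoʳ-∣ q (go ps pps r λ p pp → +-cancelˡ-≤ (valuation p q) _ _ (begin
        valuation p q + valuation p (product ps) ≡⟨ v[m*n] pp q (product ps) ⟨
        valuation p (q * product ps)             ≤⟨ v≤v p pp ⟩
        valuation p n                            ≡⟨ cong (valuation p) n≡q*r ⟩
        valuation p (q * r)                      ≡⟨ v[m*n] pp q r ⟩
        valuation p q + valuation p r            ∎)))
    where
    open ≤-Reasoning
    instance
      _ = prime⇒nonTrivial qq
      _ = prime⇒nonZero qq
      _ = productOfPrimes≢0 pps
      _ = m*n≢0 q (product ps)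
    q∣n : q ∣ n
    q∣n = subst (_∣ n) (*-identityʳ q) (k≤v⇒p^k∣m q {1} n (≤-trans
      (p^k∣m⇒k≤v q {1} (q * product ps) (subst (_∣ q * product ps) (sym (*-identityʳ q)) (m∣m*n (product ps))))
      (v≤v q qq)))
    r = quotient q∣n
    n≡q*r = m∣n⇒n≡m*quotient q∣n
    instance _ = quotient≢0 q∣n

-- Divisibility of Fibonacci numbers

fib-+ : ∀ m n → fib (suc (m + n)) ≡ fib (suc m) * fib (suc n) + fib m * fib n
fib-+ zero          n = sym (trans (+-identityʳ _) (*-identityˡ (fib (suc n))))
fib-+ (suc zero)    n = sym (cong₂ _+_ (*-identityˡ (fib (suc n))) (*-identityˡ (fib n)))
fib-+ (suc (suc m)) n = begin
  fib (suc (suc m + n)) + fib (suc (m + n))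
    ≡⟨ cong₂ _+_ (fib-+ (suc m) n) (fib-+ m n) ⟩
  (fib (suc (suc m)) * x + fib (suc m) * y) + (fib (suc m) * x + fib m * y)
    ≡⟨ regroup (fib (suc m)) (fib m) x y ⟩
  fib (suc (suc (suc m))) * x + fib (suc (suc m)) * y ∎
  where
  open ≡-Reasoning
  x = fib (suc n)
  y = fib n
  regroup : ∀ a b x y → ((a + b) * x + a * y) + (a * x + b * y) ≡ ((a + b) + a) * x + (a + b) * y
  regroup = solve-∀

fib-coprime : ∀ n → Coprime (fib n) (fib (suc n))
fib-coprime zero    (_ , d∣1) = ∣1⇒≡1 d∣1
fib-coprime (suc n) (d∣f , d∣f+g) = fib-coprime n (∣m+n∣m⇒∣n d∣f+g d∣f , d∣f)

fib-mono-≤ : ∀ {m n} → m ≤ n → fib m ≤ fib n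
fib-mono-≤ {m} m≤n = go (≤⇒≤′ m≤n)
  where
  step : ∀ n → fib n ≤ fib (suc n)
  step zero    = z≤n
  step (suc n) = m≤m+n _ _
  go : ∀ {n} → m ≤′ n → fib m ≤ fib n
  go ≤′-refl       = ≤-refl
  go (≤′-step {n} m≤n) = ≤-trans (go m≤n) (step n)

d∣fib[m]∧d∣fib[n]⇒d∣fib[m+n] : ∀ {d} m n → d ∣ fib m → d ∣ fib n → d ∣ fib (m + n)
d∣fib[m]∧d∣fib[n]⇒d∣fib[m+n] {d} zero    n _   d∣n = d∣n
d∣fib[m]∧d∣fib[n]⇒d∣fib[m+n] {d} (suc m) n d∣m d∣n =
  subst (d ∣_) (sym (fib-+ m n)) (∣m∣n⇒∣m+n (∣m⇒∣m*n _ d∣m) (∣n⇒∣m*n (fib m) d∣n))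

-- By the addition law d divides F_{m-1} F_n, and d is coprime to F_{m-1} because it divides the
-- neighbour F_m.
d∣fib[m+n]∧d∣fib[m]⇒d∣fib[n] : ∀ {d} m n → d ∣ fib (m + n) → d ∣ fib m → d ∣ fib n
d∣fib[m+n]∧d∣fib[m]⇒d∣fib[n] {d} zero    n d∣m+n _   = d∣m+n
d∣fib[m+n]∧d∣fib[m]⇒d∣fib[n] {d} (suc m) n d∣m+n d∣m =
  coprime-divisor {n = fib m}
    (λ { (e∣d , e∣fm) → fib-coprime m (e∣fm , ∣-trans e∣d d∣m) })
    (∣m+n∣m⇒∣n (subst (d ∣_) (fib-+ m n) d∣m+n) (∣m⇒∣m*n _ d∣m))

d∣fib[m]⇒d∣fib[k*m] : ∀ {d} m k → d ∣ fib m → d ∣ fib (k * m)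
d∣fib[m]⇒d∣fib[k*m] m zero    _   = _ ∣0
d∣fib[m]⇒d∣fib[k*m] m (suc k) d∣m = d∣fib[m]∧d∣fib[n]⇒d∣fib[m+n] m (k * m) d∣m (d∣fib[m]⇒d∣fib[k*m] m k d∣m)

m∣n⇒fib[m]∣fib[n] : ∀ {m n} → m ∣ n → fib m ∣ fib n
m∣n⇒fib[m]∣fib[n] {m} (divides k refl) = d∣fib[m]⇒d∣fib[k*m] m k ∣-refl

-- Entry points of arbitrary moduli

module _ {d z} (entry : IsEntryPoint d z) where
  open IsEntryPoint entry renaming (divides to d∣fib[z])

  entry∣n⇒d∣fib[n] : ∀ {n} → z ∣ n → d ∣ fib n
  entry∣n⇒d∣fib[n] z∣n = ∣-trans d∣fib[z] (m∣n⇒fib[m]∣fib[n] {z} z∣n)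

  -- Euclidean division: removing the multiple of z from the index leaves d ∣ F_{n mod z}, and
  -- minimality of z forces the remainder to be 0.
  d∣fib[n]⇒entry∣n : ∀ {n} → d ∣ fib n → z ∣ n
  d∣fib[n]⇒entry∣n {n} d∣n = m%n≡0⇒n∣m n z r≡0
    where
    instance _ = >-nonZero positive
    d∣r : d ∣ fib (n % z)
    d∣r = d∣fib[m+n]∧d∣fib[m]⇒d∣fib[n] (n / z * z) (n % z)
            (subst (λ x → d ∣ fib x) (trans (m≡m%n+[m/n]*n n z) (+-comm (n % z) _)) d∣n)
            (d∣fib[m]⇒d∣fib[k*m] z (n / z) d∣fib[z])
    r≡0 : n % z ≡ 0
    r≡0 with n % z | d∣r | m%n<n n z
    ... | zero  | _   | _   = refl
    ... | suc r | d∣r | r<z = contradiction (minimal (suc r) z<s d∣r) (<⇒≱ r<z)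

entry-exists : ∀ {d} n → 1 ≤ n → d ∣ fib n → ∃[ z ] (z ≤ n × IsEntryPoint d z)
entry-exists {d} n 1≤n d∣n = go n n ≤-refl 1≤n d∣n
  where
  -- Descent to a smaller index as long as one exists; b bounds n and decreases, for termination.
  go : ∀ b n → n ≤ b → 1 ≤ n → d ∣ fib n → ∃[ z ] (z ≤ n × IsEntryPoint d z)
  go zero    n n≤0 1≤n _ = contradiction (≤-trans 1≤n n≤0) λ ()
  go (suc b) n n≤b 1≤n d∣n with anyUpTo? (λ k → (1 ≤? k) ×-dec (d ∣? fib k)) n
  ... | no none = n , ≤-refl , record
    { positive = 1≤n ; divides = d∣n
    ; minimal = λ k 1≤k d∣k → ≮⇒≥ λ k<n → none (k , k<n , 1≤k , d∣k) }
  ... | yes (k , k<n , 1≤k , d∣k) with go b k (s≤s⁻¹ (≤-trans k<n n≤b)) 1≤k d∣k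
  ...   | z , z≤k , e = z , ≤-trans z≤k (<⇒≤ k<n) , e

-- The expansion of F_{kn} and its consequences for prime powers

triangle : ℕ → ℕ
triangle zero    = 0
triangle (suc n) = triangle n + n

-- Identifies `triangle` with the binomial coefficient C(n,2) without a division; it yields p ∣
-- C(p,2) for odd primes p.
2*triangle : ∀ n → 2 * triangle (suc n) ≡ suc n * n
2*triangle zero    = refl
2*triangle (suc n) = begin
  2 * (triangle (suc n) + suc n)     ≡⟨ *-distribˡ-+ 2 (triangle (suc n)) (suc n) ⟩
  2 * triangle (suc n) + 2 * suc n   ≡⟨ cong (_+ 2 * suc n) (2*triangle n) ⟩
  suc n * n + 2 * suc n              ≡⟨ regroup n ⟩
  suc (suc n) * suc n                ∎
  where
  open ≡-Reasoning
  regroup : ∀ n → suc n * n + 2 * suc n ≡ suc (suc n) * suc n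
  regroup = solve-∀

-- The binomial expansion of the (k+2)-nd power of the Fibonacci matrix
-- ((a + b, a), (a, b)) modulo a³, for a = F_{m+1} and b = F_m.  The lower right
-- entry is needed modulo a² only.
fib-multiple : ∀ m k → let a = fib (suc m) ; b = fib m ; l = 2 + k in
  ∃[ r ] fib (l * suc m) ≡ a * (l * b ^ suc k + a * (triangle l * b ^ k + a * r))
fib-multiple m k = proj₁ (go k) , proj₁ (proj₂ (proj₂ (go k)))
  where
  open ≡-Reasoning
  a = fib (suc m)
  b = fib m
  go : ∀ k → ∃[ r ] ∃[ s ]
    (fib ((2 + k) * suc m) ≡ a * ((2 + k) * b ^ suc k + a * (triangle (2 + k) * b ^ k + a * r)) ×
     fib (m + (1 + k) * suc m) ≡ b ^ (2 + k) + a * (a * s))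
  go zero = 0 , 1 , eq₁ , eq₂
    where
    expand₁ : ∀ a b → (a + b) * a + a * b ≡ a * (2 * (b * 1) + a * (1 * 1 + a * 0))
    expand₁ = solve-∀
    expand₂ : ∀ a b → a * a + b * b ≡ b * (b * 1) + a * (a * 1)
    expand₂ = solve-∀
    eq₁ : fib (2 * suc m) ≡ a * (2 * b ^ 1 + a * (1 * b ^ 0 + a * 0))
    eq₁ = begin
      fib (suc (m + (suc m + 0)))  ≡⟨ cong (λ x → fib (suc (m + x))) (+-identityʳ (suc m)) ⟩
      fib (suc (m + suc m))        ≡⟨ fib-+ m (suc m) ⟩
      a * (a + b) + b * a          ≡⟨ cong₂ _+_ (*-comm a (a + b)) (*-comm b a) ⟩
      (a + b) * a + a * b          ≡⟨ expand₁ a b ⟩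
      _                            ∎
    eq₂ : fib (m + 1 * suc m) ≡ b ^ 2 + a * (a * 1)
    eq₂ = begin
      fib (m + suc (m + 0))  ≡⟨ cong fib (trans (cong (λ x → m + suc x) (+-identityʳ m)) (+-suc m m)) ⟩
      fib (suc (m + m))      ≡⟨ fib-+ m m ⟩
      a * a + b * b          ≡⟨ expand₂ a b ⟩
      _                      ∎
  go (suc k) with go k
  ... | r , s , x≡ , y≡ = r′ , s′ , eq₁ , eq₂
    where
    N = m + (1 + k) * suc m
    x = fib (suc N)
    y = fib N
    B = b ^ k
    t = triangle (2 + k)
    -- The remainders are read off after one more multiplication by the Fibonacci matrix: `r′` is
    -- the coefficient left at a³, `s′` the one left at a².
    r′ = t * B + (a + b) * r + s
    s′ = (2 + k) * (b * B) + a * (t * B + a * r) + b * s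
    expand₁ : ∀ a b k B t r s →
      a * (a * ((2 + k) * (b * B) + a * (t * B + a * r)) + (b * (b * B) + a * (a * s)))
        + b * (a * ((2 + k) * (b * B) + a * (t * B + a * r)))
      ≡ a * ((3 + k) * (b * (b * B)) + a * ((t + (2 + k)) * (b * B) + a * (t * B + (a + b) * r + s)))
    expand₁ = solve-∀
    expand₂ : ∀ a b k B t r s →
      a * (a * ((2 + k) * (b * B) + a * (t * B + a * r))) + b * (b * (b * B) + a * (a * s))
      ≡ b * (b * (b * B)) + a * (a * ((2 + k) * (b * B) + a * (t * B + a * r) + b * s))
    expand₂ = solve-∀
    eq₁ : fib ((3 + k) * suc m) ≡ a * ((3 + k) * b ^ (2 + k) + a * (triangle (3 + k) * b ^ suc k + a * r′))
    eq₁ = begin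
      fib (suc (m + suc N))          ≡⟨ fib-+ m (suc N) ⟩
      a * (x + y) + b * x            ≡⟨ cong₂ (λ x y → a * (x + y) + b * x) x≡ y≡ ⟩
      _                              ≡⟨ expand₁ a b k B t r s ⟩
      _                              ∎
    eq₂ : fib (m + (2 + k) * suc m) ≡ b ^ (3 + k) + a * (a * s′)
    eq₂ = begin
      fib (m + suc N)                ≡⟨ cong fib (+-suc m N) ⟩
      fib (suc (m + N))              ≡⟨ fib-+ m N ⟩
      a * x + b * y                  ≡⟨ cong₂ (λ x y → a * x + b * y) x≡ y≡ ⟩
      _                              ≡⟨ expand₂ a b k B t r s ⟩
      _                              ∎

prime∣m^k⇒prime∣m : ∀ {p} → Prime p → ∀ m k → p ∣ m ^ k → p ∣ m
prime∣m^k⇒prime∣m pp m zero    p∣1 =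
    contradiction pp λ pp → nonTrivial⇒≢1 {{prime⇒nonTrivial pp}} (∣1⇒≡1 p∣1)
prime∣m^k⇒prime∣m pp m (suc k) p∣  = [ id , prime∣m^k⇒prime∣m pp m k ]′ (euclidsLemma m (m ^ k) pp p∣)

prime∤m∧p²∣m*n⇒p²∣n : ∀ {p m n} → Prime p → ¬ (p ∣ m) → p * p ∣ m * n → p * p ∣ n
prime∤m∧p²∣m*n⇒p²∣n {p} {m} {n} pp p∤m p²∣mn with euclidsLemma m n pp (m*n∣⇒m∣ p p p²∣mn)
... | inj₁ p∣m = contradiction p∣m p∤m
... | inj₂ (divides q refl) with euclidsLemma m q pp (*-cancelʳ-∣ p {{prime⇒nonZero pp}} (subst (p * p ∣_) (sym (*-assoc m q p)) p²∣mn))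
...   | inj₁ p∣m = contradiction p∣m p∤m
...   | inj₂ p∣q = *-monoˡ-∣ p p∣q

module _ {p} (pp : Prime p) m (p∣a : p ∣ fib (suc m)) where
  private
    a = fib (suc m)
    b = fib m

    p∤b : ¬ (p ∣ b)
    p∤b p∣b = nonTrivial⇒≢1 {{prime⇒nonTrivial pp}} (fib-coprime m (p∣b , p∣a))

    p∤b^k : ∀ k → ¬ (p ∣ b ^ k)
    p∤b^k k = p∤b ∘ prime∣m^k⇒prime∣m pp b k

  -- Modulo p the quotient F_{kn} / F_n is k b^{k-1}, and p divides neither k nor b, since b and a
  -- are consecutive Fibonacci numbers.
  fib-multiple-coprime : ∀ k → ¬ (p ∣ k) → ∃[ r ] (fib (k * suc m) ≡ a * r × ¬ (p ∣ r))
  fib-multiple-coprime zero          p∤0 = contradiction (p ∣0) p∤0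
  fib-multiple-coprime (suc zero)    p∤1 =
      1 , trans (cong fib (+-identityʳ (suc m))) (sym (*-identityʳ a)) , p∤1
  fib-multiple-coprime (suc (suc k)) p∤l with fib-multiple m k
  ... | r , eq = _ , eq , λ p∣R →
    [ p∤l , p∤b^k (suc k) ]′ (euclidsLemma (2 + k) (b ^ suc k) pp
      (∣m+n∣m⇒∣n (subst (p ∣_) (+-comm ((2 + k) * b ^ suc k) _) p∣R) (∣m⇒∣m*n _ p∣a)))

  -- Modulo p the quotient F_{pn} / F_n is p b^{p-1}, hence 0. Modulo p² it is still p b^{p-1}, and
  -- so nonzero, provided the tail a (C(p,2) b^{p-2} + a s) vanishes; the side condition is what
  -- guarantees that.
  fib-multiple-prime : ∃[ r ] (fib (p * suc m) ≡ a * r × p ∣ r × (p ≢ 2 ⊎ 4 ∣ a → ¬ (p * p ∣ r)))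
  fib-multiple-prime = go p refl
    where
    go : ∀ q → q ≡ p → ∃[ r ] (fib (q * suc m) ≡ a * r × p ∣ r × (p ≢ 2 ⊎ 4 ∣ a → ¬ (p * p ∣ r)))
    go zero          refl = contradiction pp ¬prime[0]
    go (suc zero)    refl = contradiction pp ¬prime[1]
    go (suc (suc k)) refl with fib-multiple m k
    ... | s , eq = _ , eq , ∣m∣n⇒∣m+n (m∣m*n (b ^ suc k)) (∣m⇒∣m*n _ p∣a) , λ good p²∣R →
        p∤b^k (suc k) (*-cancelˡ-∣ p (∣m+n∣m⇒∣n (subst (p * p ∣_) (+-comm (p * b ^ suc k) _) p²∣R) (p²∣tail good)))
      where
      p∣t : p ≢ 2 → p ∣ triangle p
      p∣t p≢2 with euclidsLemma 2 (triangle p) pp (subst (p ∣_) (sym (2*triangle (suc k))) (m∣m*n (suc k)))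
      ... | inj₂ p∣t = p∣t
      ... | inj₁ p∣2 = contradiction (≤-antisym (∣⇒≤ p∣2) (s≤s (s≤s z≤n))) p≢2
      p²∣tail : p ≢ 2 ⊎ 4 ∣ a → p * p ∣ a * (triangle p * b ^ k + a * s)
      p²∣tail (inj₁ p≢2) = *-pres-∣ p∣a (∣m∣n⇒∣m+n (∣m⇒∣m*n (b ^ k) (p∣t p≢2)) (∣m⇒∣m*n s p∣a))
      p²∣tail (inj₂ 4∣a) with p ≟ 2
      ... | yes refl = ∣m⇒∣m*n _ 4∣a
      ... | no  p≢2  = p²∣tail (inj₁ p≢2)

p^1+j∣d⇒p∣d : ∀ {p j d} → p ^ suc j ∣ d → p ∣ d
p^1+j∣d⇒p∣d {p} {j} = ∣-trans (m∣m*n (p ^ j))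

-- Equivalent to z(p^{j+1}) ≠ z(p^j): if p^{j+1} divided F_n at n = z(p^j), then n would be the
-- entry point of p^{j+1} too. The quantifier over n replaces a function z.
ExactAt : ℕ → ℕ → Set
ExactAt p j = ∀ n → IsEntryPoint (p ^ j) n → ¬ (p ^ suc j ∣ fib n)

-- If n = z(p^{j+1}) and p^{j+2} ∤ F_n, then z(p^{j+2}) = p n, and p divides
-- F_{pn} / F_n exactly once.
exact-step : ∀ {p} → Prime p → ∀ j → p ≢ 2 ⊎ 1 ≤ j → ExactAt p (suc j) → ExactAt p (suc (suc j))
exact-step {p} pp j good exact n entry′ p^3+j∣fn
  with entry-exists n (IsEntryPoint.positive entry′) (∣-trans (n∣m*n p) (IsEntryPoint.divides entry′))
... | zero , _ , entry = contradiction (IsEntryPoint.positive entry) λ ()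
... | suc m , _ , entry = contradiction p²∣r (proj₂ (proj₂ (proj₂ ratio)) (case good))
  where
  instance
    _ = prime⇒nonTrivial pp
    _ = prime⇒nonZero pp
  open IsEntryPoint entry renaming (divides to p^1+j∣a)
  a = fib (suc m)
  c = quotient p^1+j∣a
  a≡ : a ≡ p ^ suc j * c
  a≡ = m∣n⇒n≡m*quotient p^1+j∣a
  p∤c : ¬ (p ∣ c)
  p∤c p∣c = exact (suc m) entry (subst₂ _∣_ (*-comm (p ^ suc j) p) (sym a≡) (*-monoʳ-∣ (p ^ suc j) p∣c))
  p∣a : p ∣ a
  p∣a = p^1+j∣d⇒p∣d {p} {j} p^1+j∣a
  -- For p = 2 the bound 1 ≤ j gives 4 ∣ 2^{j+1} ∣ a.
  case : p ≢ 2 ⊎ 1 ≤ j → p ≢ 2 ⊎ 4 ∣ a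
  case (inj₁ p≢2) = inj₁ p≢2
  case (inj₂ 1≤j) with p ≟ 2
  ... | no p≢2 = inj₁ p≢2
  ... | yes refl = inj₂ (four j 1≤j p^1+j∣a)
    where
    four : ∀ j → 1 ≤ j → 2 ^ suc j ∣ a → 4 ∣ a
    four (suc j) _ = ∣-trans (subst (4 ∣_) (*-assoc 2 2 (2 ^ j)) (m∣m*n (2 ^ j)))
  ratio = fib-multiple-prime pp m p∣a
  instance _ = m^n≢0 p (suc j)
  -- Divides by the exact power of p in a, leaving the cofactor c prime to p.
  cancel : ∀ {q r} → p ^ suc j * q ∣ a * r → q ∣ c * r
  cancel {q} {r} d =
      *-cancelˡ-∣ (p ^ suc j) (subst (p ^ suc j * q ∣_) (trans (cong (_* r) a≡) (*-assoc (p ^ suc j) c r)) d)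
  1+m∣n : suc m ∣ n
  1+m∣n = d∣fib[n]⇒entry∣n entry (∣-trans (n∣m*n p) (IsEntryPoint.divides entry′))
  k = quotient 1+m∣n
  n≡ : n ≡ k * suc m
  n≡ = m∣n⇒n≡quotient*m 1+m∣n
  -- If p did not divide k, then F_n would contain no more factors p than a does, against p^{j+2} ∣
  -- F_n.
  p∣k : p ∣ k
  p∣k with p ∣? k
  ... | yes p∣k = p∣k
  ... | no  p∤k with fib-multiple-coprime pp m p∣a k p∤k
  ...   | r , eq , p∤r = contradiction
            (euclidsLemma c r pp (cancel (subst₂ _∣_ (*-comm p (p ^ suc j)) (trans (cong fib n≡) eq) (IsEntryPoint.divides entry′))))
            [ p∤c , p∤r ]′
  n≤p*1+m : n ≤ p * suc m
  n≤p*1+m = IsEntryPoint.minimal entry′ (p * suc m) (>-nonZero⁻¹ _ {{m*n≢0 p (suc m)}})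
    (subst₂ _∣_ (*-comm (p ^ suc j) p) (sym (proj₁ (proj₂ ratio))) (*-pres-∣ p^1+j∣a (proj₁ (proj₂ (proj₂ ratio)))))
  n≡p*1+m : n ≡ p * suc m
  n≡p*1+m = ≤-antisym n≤p*1+m (subst (p * suc m ≤_) (sym n≡) (*-monoˡ-≤ (suc m) (∣⇒≤ {{k≢0}} p∣k)))
    where
    k≢0 : NonZero k
    k≢0 = quotient≢0 1+m∣n {{>-nonZero (IsEntryPoint.positive entry′)}}
  p²∣r : p * p ∣ proj₁ ratio
  p²∣r =
      prime∤m∧p²∣m*n⇒p²∣n pp p∤c (cancel (subst₂ _∣_ p^3+j≡ (trans (cong fib n≡p*1+m) (proj₁ (proj₂ ratio))) p^3+j∣fn))
    where
    p^3+j≡ : p ^ (3 + j) ≡ p ^ suc j * (p * p)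
    p^3+j≡ = trans (sym (*-assoc p p (p ^ suc j))) (*-comm (p * p) (p ^ suc j))

exact-odd : ∀ {p} → Prime p → p ≢ 2 → ExactAt p 1 → ∀ j → ExactAt p (suc j)
exact-odd pp p≢2 exact zero    = exact
exact-odd pp p≢2 exact (suc j) = exact-step pp j (inj₁ p≢2) (exact-odd pp p≢2 exact j)

isEntryPoint-unique : ∀ {d m n} → IsEntryPoint d m → IsEntryPoint d n → m ≡ n
isEntryPoint-unique e f = ≤-antisym
  (IsEntryPoint.minimal e _ (IsEntryPoint.positive f) (IsEntryPoint.divides f))
  (IsEntryPoint.minimal f _ (IsEntryPoint.positive e) (IsEntryPoint.divides e))

-- For concrete d and n, minimality becomes a bounded search, so that z(2) = 3 and z(4) = z(8) = 6
-- are obtained by evaluation.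
isEntryPoint-check : ∀ d n → 1 ≤ n → d ∣ fib n → (∀ {k} → k < n → ¬ (1 ≤ k × d ∣ fib k)) → IsEntryPoint d n
isEntryPoint-check d n 1≤n d∣n none = record
  { positive = 1≤n ; divides = d∣n ; minimal = λ k 1≤k d∣k → ≮⇒≥ λ k<n → none k<n (1≤k , d∣k) }

no-earlier? : ∀ d n → Dec (∀ {k} → k < n → ¬ (1 ≤ k × d ∣ fib k))
no-earlier? d n = allUpTo? (λ k → ¬? ((1 ≤? k) ×-dec (d ∣? fib k))) n

-- At 2 one has F_3 = 2. At 4 exactness really fails, as z(4) = 6 and 8 ∣ F_6, which is the case
-- that n ≠ 6 excludes. From 8 on, 16 ∤ F_6 = 8 starts the induction.
exact-two : ∀ j {n} → n ≢ 6 → IsEntryPoint (2 ^ suc j) n → ¬ (2 ^ suc (suc j) ∣ fib n)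
exact-two 0 n≢6 entry = subst (λ n → ¬ (4 ∣ fib n)) (isEntryPoint-unique entry[2] entry) (from-no (4 ∣? 2))
  where
  entry[2] : IsEntryPoint 2 3
  entry[2] = isEntryPoint-check 2 3 (s≤s z≤n) (from-yes (2 ∣? 2)) (from-yes (no-earlier? 2 3))
exact-two 1 n≢6 entry = contradiction (isEntryPoint-unique entry entry[4]) n≢6
  where
  entry[4] : IsEntryPoint 4 6
  entry[4] = isEntryPoint-check 4 6 (s≤s z≤n) (from-yes (4 ∣? 8)) (from-yes (no-earlier? 4 6))
exact-two (suc (suc j)) _ entry = go j _ entry
  where
  entry[8] : IsEntryPoint 8 6
  entry[8] = isEntryPoint-check 8 6 (s≤s z≤n) (from-yes (8 ∣? 8)) (from-yes (no-earlier? 8 6))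
  go : ∀ j → ExactAt 2 (3 + j)
  go zero    n entry = subst (λ n → ¬ (16 ∣ fib n)) (isEntryPoint-unique entry[8] entry) (from-no (16 ∣? 8))
  go (suc j) = exact-step prime[2] (suc (suc j)) (inj₂ (s≤s z≤n)) (go j)

-- Möbius inversion

∑< : ℕ → (ℕ → ℤ) → ℤ
∑< n f = sum {n} (f ∘ toℕ)

∑<-cong : ∀ n {f g} → (∀ k → k < n → f k ≡ g k) → ∑< n f ≡ ∑< n g
∑<-cong n f≗g = sum-cong-≗ {n} λ i → f≗g (toℕ i) (toℕ<n i)

∑<-zero : ∀ n {f} → (∀ k → k < n → f k ≡ 0ℤ) → ∑< n f ≡ 0ℤ
∑<-zero n f≗0 = trans (∑<-cong n f≗0) (sum-replicate-zero n)

∑<-+ : ∀ m n f → ∑< (m + n) f ≡ ∑< m f ℤ.+ ∑< n (λ k → f (m + k))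
∑<-+ zero    n f = sym (ℤ.+-identityˡ _)
∑<-+ (suc m) n f = trans (cong (λ s → f 0 ℤ.+ s) (∑<-+ m n (f ∘ suc))) (sym (ℤ.+-assoc (f 0) _ _))

∑<-truncate : ∀ {m n} f → m ≤ n → (∀ k → m ≤ k → f k ≡ 0ℤ) → ∑< n f ≡ ∑< m f
∑<-truncate {m} {n} f m≤n f≗0 = begin
  ∑< n f                                     ≡⟨ cong (λ l → ∑< l f) (m+[n∸m]≡n m≤n) ⟨
  ∑< (m + (n ∸ m)) f                         ≡⟨ ∑<-+ m (n ∸ m) f ⟩
  ∑< m f ℤ.+ ∑< (n ∸ m) (λ k → f (m + k))
    ≡⟨ cong (λ s → ∑< m f ℤ.+ s) (∑<-zero (n ∸ m) λ k _ → f≗0 (m + k) (m≤m+n m k)) ⟩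
  ∑< m f ℤ.+ 0ℤ                              ≡⟨ ℤ.+-identityʳ _ ⟩
  ∑< m f                                     ∎
  where open ≡-Reasoning

-- The range splits into n blocks of length q, and in each block only the first term can be nonzero.
∑<-multiples : ∀ q .{{_ : NonZero q}} n f → (∀ k → ¬ (q ∣ k) → f k ≡ 0ℤ) →
               ∑< (n * q) f ≡ ∑< n (λ k → f (k * q))
∑<-multiples q zero    f f≗0 = refl
∑<-multiples q@(suc r) (suc n) f f≗0 = begin
  ∑< (q + n * q) f                                       ≡⟨ ∑<-+ q (n * q) f ⟩
  (f 0 ℤ.+ ∑< r (f ∘ suc)) ℤ.+ ∑< (n * q) (λ k → f (q + k))
    ≡⟨ cong₂ (λ x y → (f 0 ℤ.+ x) ℤ.+ y) between rest ⟩
  (f 0 ℤ.+ 0ℤ) ℤ.+ ∑< n (λ k → f (suc k * q))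
    ≡⟨ cong (λ s → s ℤ.+ ∑< n (λ k → f (suc k * q))) (ℤ.+-identityʳ (f 0)) ⟩
  ∑< (suc n) (λ k → f (k * q))                           ∎
  where
  open ≡-Reasoning
  between : ∑< r (f ∘ suc) ≡ 0ℤ
  between = ∑<-zero r λ k k<r → f≗0 (suc k) λ q∣1+k → <⇒≱ (s<s k<r) (∣⇒≤ q∣1+k)
  rest : ∑< (n * q) (λ k → f (q + k)) ≡ ∑< n (λ k → f (suc k * q))
  rest = ∑<-multiples q n (λ k → f (q + k)) λ k q∤k → f≗0 (q + k) λ q∣q+k → q∤k (∣m+n∣m⇒∣n q∣q+k ∣-refl)

-- Extending the sum by zeros up to n q gives both sides the same range, so that no n / q appears.
∑<-rescale : ∀ q .{{_ : NonZero q}} n f → (∀ k → ¬ (q ∣ k) → f k ≡ 0ℤ) → (∀ k → n ≤ k → f k ≡ 0ℤ) →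
             ∑< n f ≡ ∑< n (λ k → f (k * q))
∑<-rescale q n f f≗0 f≗0′ = trans (sym (∑<-truncate f (m≤m*n n q) f≗0′)) (∑<-multiples q n f f≗0)

-- The body of `μ` as a function of the list of primes. Being invariant under permutation, it lets μ
-- be evaluated on any factorisation at hand, in particular on one with a prime prepended.
signOf : List ℕ → ℤ
signOf ps = if does (unique? _≟_ ps) then -1ℤ ℤ.^ length ps else 0ℤ

signOf-unique : ∀ {ps} → Unique ps → signOf ps ≡ -1ℤ ℤ.^ length ps
signOf-unique {ps} u rewrite dec-true (unique? _≟_ ps) u = refl

signOf-¬unique : ∀ {ps} → ¬ Unique ps → signOf ps ≡ 0ℤ
signOf-¬unique {ps} ¬u rewrite dec-false (unique? _≟_ ps) ¬u = refl

signOf-↭ : ∀ {ps qs} → ps ↭ qs → signOf ps ≡ signOf qs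
signOf-↭ {ps} {qs} ps↭qs with unique? _≟_ qs
... | yes u = trans (signOf-unique (Permutation.Unique-resp-↭ (setoid ℕ) (↭⇒↭ₛ (↭-sym ps↭qs)) u))
                    (cong (-1ℤ ℤ.^_) (↭-length ps↭qs))
... | no ¬u = signOf-¬unique (¬u ∘ Permutation.Unique-resp-↭ (setoid ℕ) (↭⇒↭ₛ ps↭qs))

μ-factors : ∀ n .{{_ : NonZero n}} (f : PrimeFactorisation n) → μ n ≡ signOf (factors f)
μ-factors n@(suc _) f = signOf-↭ (factorisationUnique (factorise n) f)

module _ {q} (qq : Prime q) m .{{_ : NonZero m}} where
  private
    open PrimeFactorisation (factorise m) using (isFactorisation; factorsPrime)
    ps = factors (factorise m)
    instance
      _ = prime⇒nonZero qq
      _ = m*n≢0 q m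

    μ[q*m] : μ (q * m) ≡ signOf (q ∷ ps)
    μ[q*m] = μ-factors (q * m) record
      { factors =
          q ∷ ps ; isFactorisation = cong (q *_) isFactorisation ; factorsPrime = qq ∷ factorsPrime }

  μ-repeated : q ∣ m → μ (q * m) ≡ 0ℤ
  μ-repeated q∣m = trans μ[q*m] (signOf-¬unique λ u → Unique[x∷xs]⇒x∉xs u
    (factorisationHasAllPrimeFactors qq (subst (q ∣_) isFactorisation q∣m) factorsPrime))

  μ-new : ¬ (q ∣ m) → μ (q * m) ≡ ℤ.- μ m
  μ-new q∤m with unique? _≟_ ps
  ... | yes u = begin
    μ (q * m)              ≡⟨ μ[q*m] ⟩
    signOf (q ∷ ps)        ≡⟨ signOf-unique (¬Any⇒All¬ ps q∉ps ∷ u) ⟩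
    -1ℤ ℤ.* -1ℤ ℤ.^ length ps ≡⟨ ℤ.-1*i≡-i _ ⟩
    ℤ.- (-1ℤ ℤ.^ length ps)   ≡⟨ cong ℤ.-_ (trans (μ-factors m (factorise m)) (signOf-unique u)) ⟨
    ℤ.- μ m                ∎
    where
    open ≡-Reasoning
    q∉ps : ¬ (q ∈ ps)
    q∉ps q∈ps = q∤m (subst (q ∣_) (sym isFactorisation) (∈⇒∣product q∈ps))
  ... | no ¬u = begin
    μ (q * m)       ≡⟨ μ[q*m] ⟩
    signOf (q ∷ ps) ≡⟨ signOf-¬unique {q ∷ ps} (λ { (_ ∷ u) → ¬u u }) ⟩
    ℤ.- 0ℤ          ≡⟨ cong ℤ.-_ (trans (μ-factors m (factorise m)) (signOf-¬unique ¬u)) ⟨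
    ℤ.- μ m         ∎
    where open ≡-Reasoning

-- The exponent μ(n/d) of F_d in the Möbius dual, extended by 0 to all d.
weight : ℕ → ℕ → ℤ
weight n zero    = 0ℤ
weight n (suc k) = if does (suc k ∣? n) then μ (n / suc k) else 0ℤ

weight-∣ : ∀ n e d .{{_ : NonZero d}} → n ≡ e * d → weight n d ≡ μ e
weight-∣ n e d@(suc _) n≡e*d rewrite dec-true (d ∣? n) (divides e n≡e*d) =
  cong μ (trans (cong (_/ d) n≡e*d) (m*n/n≡m e d))

weight-∤ : ∀ n d → ¬ (d ∣ n) → weight n d ≡ 0ℤ
weight-∤ n zero      _   = refl
weight-∤ n d@(suc _) d∤n rewrite dec-false (d ∣? n) d∤n = refl

weight-> : ∀ {n d} .{{_ : NonZero n}} → n < d → weight n d ≡ 0ℤ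
weight-> {n} {d} n<d = weight-∤ n d λ d∣n → <⇒≱ n<d (∣⇒≤ d∣n)

∑-weight[1] : ∑< 2 (weight 1) ≡ 1ℤ
∑-weight[1] = refl

∃-prime-divisor : ∀ n → 1 < n → ∃[ q ] (Prime q × q ∣ n)
∃-prime-divisor n 1<n with factors f | PrimeFactorisation.isFactorisation f | PrimeFactorisation.factorsPrime f
  where f = factorise n {{>-nonZero (<⇒≤ 1<n)}}
... | []     | n≡1 | _      = contradiction n≡1 (>⇒≢ 1<n)
... | q ∷ ps | n≡  | qq ∷ _ = q , qq , subst (q ∣_) (sym n≡) (m∣m*n (product ps))

-- For a prime q dividing n, the divisor d with n/d divisible by q cancels
-- against q d, unless q² divides n/d and both sides vanish.
∑-weight : ∀ n → 1 < n → ∑< (suc n) (weight n) ≡ 0ℤ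
∑-weight n 1<n with ∃-prime-divisor n 1<n
... | q , qq , q∣n = begin
  ∑< (suc n) (weight n)                            ≡⟨ ∑<-cong (suc n) (λ d _ → split d) ⟩
  ∑< (suc n) (λ d → u d ℤ.+ v d)                   ≡⟨ ∑-distrib-+ {suc n} (u ∘ toℕ) (v ∘ toℕ) ⟩
  ∑< (suc n) u ℤ.+ ∑< (suc n) v
    ≡⟨ cong (λ s → ∑< (suc n) u ℤ.+ s) (∑<-rescale q (suc n) v v-support v-large) ⟩
  ∑< (suc n) u ℤ.+ ∑< (suc n) (λ d → v (d * q))    ≡⟨ ∑-distrib-+ {suc n} (u ∘ toℕ) (λ i → v (toℕ i * q)) ⟨
  ∑< (suc n) (λ d → u d ℤ.+ v (d * q))             ≡⟨ ∑<-zero (suc n) (λ d _ → cancel d) ⟩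
  0ℤ                                               ∎
  where
  open ≡-Reasoning
  instance
    _ = prime⇒nonZero qq
    n≢0 = >-nonZero (<⇒≤ 1<n)
  -- `u` keeps the d with d q ∣ n and `v` the rest. Since q ∣ n, a divisor of n left in `v` must be
  -- a multiple of q; the substitution d ↦ d q then matches it with a term of `u`.
  u v : ℕ → ℤ
  u d = if does (d * q ∣? n) then weight n d else 0ℤ
  v d = if does (d * q ∣? n) then 0ℤ else weight n d
  split : ∀ d → weight n d ≡ u d ℤ.+ v d
  split d with d * q ∣? n
  ... | yes _ = sym (ℤ.+-identityʳ _)
  ... | no  _ = sym (ℤ.+-identityˡ _)
  v-∣ : ∀ d → d * q ∣ n → v d ≡ 0ℤ
  v-∣ d dq∣n rewrite dec-true (d * q ∣? n) dq∣n = refl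
  v-∤ : ∀ d → ¬ (d * q ∣ n) → v d ≡ weight n d
  v-∤ d dq∤n rewrite dec-false (d * q ∣? n) dq∤n = refl
  v-weight : ∀ d → weight n d ≡ 0ℤ → v d ≡ 0ℤ
  v-weight d w≡0 with d * q ∣? n
  ... | yes _ = refl
  ... | no  _ = w≡0
  v-support : ∀ d → ¬ (q ∣ d) → v d ≡ 0ℤ
  v-support d q∤d with d ∣? n
  ... | no d∤n = v-weight d (weight-∤ n d d∤n)
  ... | yes (divides e refl) with euclidsLemma e d qq q∣n
  ...   | inj₂ q∣d = contradiction q∣d q∤d
  ...   | inj₁ q∣e = v-∣ d (subst (_∣ e * d) (*-comm q d) (*-monoˡ-∣ d q∣e))
  v-large : ∀ d → n < d → v d ≡ 0ℤ
  v-large d n<d = v-weight d (weight-> n<d)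
  cancel : ∀ d → u d ℤ.+ v (d * q) ≡ 0ℤ
  cancel d with d * q ∣? n
  ... | no dq∤n = trans (ℤ.+-identityˡ _) (v-weight (d * q) (weight-∤ n (d * q) dq∤n))
  ... | yes (divides e n≡) = cases (q ∣? e)
    where
    instance
      e*dq≢0 : NonZero (e * (d * q))
      e*dq≢0 = subst NonZero n≡ n≢0
      e≢0 : NonZero e
      e≢0 = m*n≢0⇒m≢0 e
      dq≢0 : NonZero (d * q)
      dq≢0 = m*n≢0⇒n≢0 e
      d≢0 : NonZero d
      d≢0 = m*n≢0⇒m≢0 d
    w≡ : weight n d ≡ μ (q * e)
    w≡ =
        weight-∣ n (q * e) d (trans n≡ (trans (sym (*-assoc e d q)) (trans (*-comm (e * d) q) (sym (*-assoc q e d)))))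
    cases : Dec (q ∣ e) → weight n d ℤ.+ v (d * q) ≡ 0ℤ
    cases (yes q∣e) = cong₂ ℤ._+_ (trans w≡ (μ-repeated qq e q∣e))
      (v-∣ (d * q) (subst₂ _∣_ (*-comm q (d * q)) (sym n≡) (*-monoˡ-∣ (d * q) q∣e)))
    cases (no q∤e) = trans (cong₂ ℤ._+_ (trans w≡ (μ-new qq e q∤e))
        (trans (v-∤ (d * q) dqq∤n) (weight-∣ n e (d * q) n≡))) (ℤ.+-inverseˡ (μ e))
      where
      dqq∤n : ¬ (d * q * q ∣ n)
      dqq∤n dqq∣n = q∤e (*-cancelʳ-∣ (d * q) (subst₂ _∣_ (*-comm (d * q) q) n≡ dqq∣n))

-- The Möbius transform of the condition t ∣ F_d

χ : {P : Set} → Dec P → ℤ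
χ P? = if does P? then 1ℤ else 0ℤ

χ-true : {P : Set} (P? : Dec P) → P → χ P? ≡ 1ℤ
χ-true P? p rewrite dec-true P? p = refl

χ-false : {P : Set} (P? : Dec P) → ¬ P → χ P? ≡ 0ℤ
χ-false P? ¬p rewrite dec-false P? ¬p = refl

-- For n ≥ 1 this is the indicator of n = z(t), as shown below. With t = p^j it is the contribution
-- of p^j to v_p(M_n). The index d = 0 has weight 0 and is included so that the range can be
-- rescaled by z.
dualCount : ℕ → ℕ → ℤ
dualCount n t = ∑< (suc n) (λ d → weight n d ℤ.* χ (t ∣? fib d))

module _ {t z} (entry : IsEntryPoint t z) (m : ℕ) .{{_ : NonZero m}} where
  private
    instance
      z≢0 = >-nonZero (IsEntryPoint.positive entry)
      _ = m*n≢0 m z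

  -- Only indices d = c z survive, and (m z) / (c z) = m / c turns their weights into those of m.
  dualCount-multiple : dualCount (m * z) t ≡ ∑< (suc m) (weight m)
  dualCount-multiple = begin
    ∑< (suc n) f                   ≡⟨ ∑<-rescale z (suc n) f f-support f-large ⟩
    ∑< (suc n) (λ c → f (c * z))   ≡⟨ ∑<-cong (suc n) (λ c _ → f[c*z] c) ⟩
    ∑< (suc n) (weight m)          ≡⟨ ∑<-truncate (weight m) (s≤s (m≤m*n m z)) (λ c → weight->) ⟩
    ∑< (suc m) (weight m)          ∎
    where
    open ≡-Reasoning
    n = m * z
    f : ℕ → ℤ
    f d = weight n d ℤ.* χ (t ∣? fib d)
    f-support : ∀ d → ¬ (z ∣ d) → f d ≡ 0ℤ
    f-support d z∤d =
        trans (cong (weight n d ℤ.*_) (χ-false (t ∣? fib d) (z∤d ∘ d∣fib[n]⇒entry∣n entry))) (ℤ.*-zeroʳ (weight n d))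
    f-large : ∀ d → n < d → f d ≡ 0ℤ
    f-large d n<d = cong (ℤ._* χ (t ∣? fib d)) (weight-> n<d)
    weight-scale : ∀ c → weight n (c * z) ≡ weight m c
    weight-scale c with c ∣? m
    ... | no c∤m = trans (weight-∤ n (c * z) (c∤m ∘ *-cancelʳ-∣ z)) (sym (weight-∤ m c c∤m))
    ... | yes (divides e m≡) =
        trans (weight-∣ n e (c * z) (trans (cong (_* z) m≡) (*-assoc e c z))) (sym (weight-∣ m e c m≡))
      where
      instance
        c≢0 : NonZero c
        c≢0 = m*n≢0⇒n≢0 e {{subst NonZero m≡ (recompute-nonZero m)}}
          where
          recompute-nonZero : ∀ m .{{_ : NonZero m}} → NonZero m
          recompute-nonZero (suc _) = _
        cz≢0 : NonZero (c * z)
        cz≢0 = m*n≢0 c z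
    f[c*z] : ∀ c → f (c * z) ≡ weight m c
    f[c*z] c =
        trans (cong₂ ℤ._*_ (weight-scale c) (χ-true (t ∣? fib (c * z)) (entry∣n⇒d∣fib[n] entry (n∣m*n c)))) (ℤ.*-identityʳ _)

dualCount-entry : ∀ {n t} → IsEntryPoint t n → dualCount n t ≡ 1ℤ
dualCount-entry {n} {t} entry = begin
  dualCount n t        ≡⟨ cong (λ n → dualCount n t) (*-identityˡ n) ⟨
  dualCount (1 * n) t  ≡⟨ dualCount-multiple entry 1 ⟩
  ∑< 2 (weight 1)      ≡⟨ ∑-weight[1] ⟩
  1ℤ                   ∎
  where open ≡-Reasoning

-- Either t ∤ F_n, and then t divides F_d for no d ∣ n; or n is a multiple m z with m ≥ 2, and the
-- Möbius sum over the divisors of m vanishes.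
dualCount-¬entry : ∀ {n t} → 1 ≤ n → ¬ IsEntryPoint t n → dualCount n t ≡ 0ℤ
dualCount-¬entry {n} {t} 1≤n ¬entry with t ∣? fib n
... | no t∤fn = ∑<-zero (suc n) λ d _ → vanish d
  where
  vanish : ∀ d → weight n d ℤ.* χ (t ∣? fib d) ≡ 0ℤ
  vanish d with d ∣? n
  ... | no d∤n  = cong (ℤ._* χ (t ∣? fib d)) (weight-∤ n d d∤n)
  ... | yes d∣n =
      trans (cong (weight n d ℤ.*_) (χ-false (t ∣? fib d) λ t∣fd → t∤fn (∣-trans t∣fd (m∣n⇒fib[m]∣fib[n] {d} d∣n))))
                        (ℤ.*-zeroʳ (weight n d))
... | yes t∣fn with entry-exists n 1≤n t∣fn
...   | z , _ , entry with d∣fib[n]⇒entry∣n entry {n} t∣fn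
...     | divides 0 refl = contradiction 1≤n λ ()
...     | divides 1 refl = contradiction (subst (IsEntryPoint t) (sym (*-identityˡ z)) entry) ¬entry
...     | divides (suc (suc m)) refl =
    trans (dualCount-multiple entry (2 + m)) (∑-weight (2 + m) (s≤s (s≤s z≤n)))

-- Valuations of the Möbius dual

-- Division by 1 normalises through a gcd and is stuck on a variable, whereas `fromℤ` is already in
-- normal form.
/1≡fromℤ : ∀ i → i ℚ./ 1 ≡ fromℤ i
/1≡fromℤ i = ℚ.↥p/↧p≡p (fromℤ i)

fromℤ-* : ∀ i j → fromℤ i ℚ.* fromℤ j ≡ fromℤ (i ℤ.* j)
fromℤ-* i j = /1≡fromℤ (i ℤ.* j)

fromℤ-injective : ∀ {i j} → fromℤ i ≡ fromℤ j → i ≡ j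
fromℤ-injective = cong ℚ.numerator

1/n*n≡1 : ∀ n .{{_ : NonZero n}} → (+ 1 ℚ./ n) ℚ.* fromℤ (+ n) ≡ fromℤ 1ℤ
1/n*n≡1 n@(suc k) = ℚ.toℚᵘ-injective (begin-equality
  ℚ.toℚᵘ ((+ 1 ℚ./ n) ℚ.* fromℤ (+ n))            ≃⟨ ℚ.toℚᵘ-homo-* (+ 1 ℚ./ n) (fromℤ (+ n)) ⟩
  ℚ.toℚᵘ (+ 1 ℚ./ n) ℚᵘ.* ℚᵘ.mkℚᵘ (+ n) 0
    ≃⟨ ℚᵘ.*-congʳ {ℚᵘ.mkℚᵘ (+ n) 0} (ℚ.toℚᵘ-fromℚᵘ (ℚᵘ.mkℚᵘ (+ 1) k)) ⟩
  ℚᵘ.mkℚᵘ (+ 1) k ℚᵘ.* ℚᵘ.mkℚᵘ (+ n) 0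
    ≃⟨ ℚᵘ.*≡* (cong +_ (trans (*-identityʳ (n + 0)) (cong (_+ 0) (sym (*-identityʳ n))))) ⟩
  ℚᵘ.mkℚᵘ (+ 1) 0                                 ∎)
  where open ℚᵘ.≤-Reasoning

fromℤ-cancelʳ : ∀ n .{{_ : NonZero n}} {q r} → q ℚ.* fromℤ (+ n) ≡ r ℚ.* fromℤ (+ n) → q ≡ r
fromℤ-cancelʳ n {q} {r} eq = trans (sym (undo q)) (trans (cong (ℚ._* (+ 1 ℚ./ n)) eq) (undo r))
  where
  undo : ∀ q → (q ℚ.* fromℤ (+ n)) ℚ.* (+ 1 ℚ./ n) ≡ q
  undo q = begin
    (q ℚ.* fromℤ (+ n)) ℚ.* (+ 1 ℚ./ n) ≡⟨ ℚ.*-assoc q _ _ ⟩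
    q ℚ.* (fromℤ (+ n) ℚ.* (+ 1 ℚ./ n))
      ≡⟨ cong (q ℚ.*_) (trans (ℚ.*-comm (fromℤ (+ n)) (+ 1 ℚ./ n)) (1/n*n≡1 n)) ⟩
    q ℚ.* 1ℚ                            ≡⟨ ℚ.*-identityʳ q ⟩
    q                                   ∎
    where open ≡-Reasoning

fromℤ-pos-* : ∀ m n → fromℤ (+ (m * n)) ≡ fromℤ (+ m) ℚ.* fromℤ (+ n)
fromℤ-pos-* m n = trans (cong fromℤ (ℤ.pos-* m n)) (sym (fromℤ-* (+ m) (+ n)))

-- The integer v p is the signed p-adic valuation of q. The fraction may be unreduced, so that a
-- product simply multiplies numerators and denominators, and the relation is additive to keep
-- `valuation` on the naturals.
record HasValuations (q : ℚ) (v : ℕ → ℤ) : Set where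
  field
    num den         : ℕ
    {{num≢0}}       : NonZero num
    {{den≢0}}       : NonZero den
    q*den≡num       : q ℚ.* fromℤ (+ den) ≡ fromℤ (+ num)
    valuation-num   : ∀ {p} → Prime p → + valuation p num ≡ + valuation p den ℤ.+ v p

hasValuations-cong : ∀ {q v w} → (∀ {p} → Prime p → v p ≡ w p) → HasValuations q v → HasValuations q w
hasValuations-cong v≗w h = record
  { HasValuations h
  ; valuation-num = λ pp → trans (valuation-num pp) (cong (λ i → + valuation _ den ℤ.+ i) (v≗w pp)) }
  where open HasValuations h

hasValuations-1 : HasValuations 1ℚ (λ _ → 0ℤ)
hasValuations-1 =
    record { num = 1 ; den = 1 ; q*den≡num = refl ; valuation-num = λ _ → sym (ℤ.+-identityʳ _) }

hasValuations-* : ∀ {q r v w} → HasValuations q v → HasValuations r w →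
                  HasValuations (q ℚ.* r) (λ p → v p ℤ.+ w p)
hasValuations-* {q} {r} {v} {w} h k = record
  { num       = H.num * K.num
  ; den       = H.den * K.den
  ; num≢0     = m*n≢0 H.num K.num
  ; den≢0     = m*n≢0 H.den K.den
  ; q*den≡num = begin
      (q ℚ.* r) ℚ.* fromℤ (+ (H.den * K.den))
        ≡⟨ cong ((q ℚ.* r) ℚ.*_) (fromℤ-pos-* H.den K.den) ⟩
      (q ℚ.* r) ℚ.* (fromℤ (+ H.den) ℚ.* fromℤ (+ K.den))
        ≡⟨ interchange (CommutativeMonoid.commutativeSemigroup ℚ.*-1-commutativeMonoid) q r _ _ ⟩
      (q ℚ.* fromℤ (+ H.den)) ℚ.* (r ℚ.* fromℤ (+ K.den))       ≡⟨ cong₂ ℚ._*_ H.q*den≡num K.q*den≡num ⟩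
      fromℤ (+ H.num) ℚ.* fromℤ (+ K.num)                       ≡⟨ fromℤ-pos-* H.num K.num ⟨
      fromℤ (+ (H.num * K.num))                                 ∎
  ; valuation-num = λ {p} pp → begin
      + valuation p (H.num * K.num)                             ≡⟨ cong +_ (v[m*n] pp H.num K.num) ⟩
      + valuation p H.num ℤ.+ + valuation p K.num
        ≡⟨ cong₂ ℤ._+_ (H.valuation-num pp) (K.valuation-num pp) ⟩
      (+ valuation p H.den ℤ.+ v p) ℤ.+ (+ valuation p K.den ℤ.+ w p)
        ≡⟨ interchange (CommutativeMonoid.commutativeSemigroup ℤ.+-0-commutativeMonoid)
           (+ valuation p H.den) (v p) (+ valuation p K.den) (w p) ⟩
      + (valuation p H.den + valuation p K.den) ℤ.+ (v p ℤ.+ w p)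
        ≡⟨ cong (λ m → + m ℤ.+ (v p ℤ.+ w p)) (v[m*n] pp H.den K.den) ⟨
      + valuation p (H.den * K.den) ℤ.+ (v p ℤ.+ w p)           ∎
  }
  where
  open ≡-Reasoning
  module H = HasValuations h
  module K = HasValuations k

hasValuations-^ : ∀ a .{{_ : NonZero a}} e → HasValuations (a ^ℤ e) (λ p → e ℤ.* + valuation p a)
hasValuations-^ a (+ k) = record
  { num       = a ^ k
  ; den       = 1
  ; num≢0     = m^n≢0 a k
  ; q*den≡num = trans (ℚ.*-identityʳ _) (/1≡fromℤ (+ (a ^ k)))
  ; valuation-num = λ {p} pp → begin
      + valuation p (a ^ k)                    ≡⟨ cong +_ (v[m^k] pp a k) ⟩
      + (k * valuation p a)                    ≡⟨ ℤ.pos-* k (valuation p a) ⟩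
      + k ℤ.* + valuation p a                  ≡⟨ ℤ.+-identityˡ _ ⟨
      + 0 ℤ.+ + k ℤ.* + valuation p a          ≡⟨ cong (λ m → + m ℤ.+ + k ℤ.* + valuation p a) (v[1] pp) ⟨
      + valuation p 1 ℤ.+ + k ℤ.* + valuation p a ∎
  }
  where open ≡-Reasoning
hasValuations-^ a -[1+ k ] = record
  { num       = 1
  ; den       = a ^ suc k
  ; den≢0     = m^n≢0 a (suc k)
  ; q*den≡num = 1/n*n≡1 (a ^ suc k) {{m^n≢0 a (suc k)}}
  ; valuation-num = λ {p} pp → let l = + valuation p a in begin
      + valuation p 1                                ≡⟨ cong +_ (v[1] pp) ⟩
      0ℤ                                             ≡⟨ ℤ.+-inverseʳ (+ suc k ℤ.* l) ⟨
      + suc k ℤ.* l ℤ.- + suc k ℤ.* l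
        ≡⟨ cong (λ i → + suc k ℤ.* l ℤ.+ i) (ℤ.neg-distribˡ-* (+ suc k) l) ⟩
      + suc k ℤ.* l ℤ.+ -[1+ k ] ℤ.* l
        ≡⟨ cong (λ i → i ℤ.+ -[1+ k ] ℤ.* l) (ℤ.pos-* (suc k) (valuation p a)) ⟨
      + (suc k * valuation p a) ℤ.+ -[1+ k ] ℤ.* l
        ≡⟨ cong (λ m → + m ℤ.+ -[1+ k ] ℤ.* l) (v[m^k] pp a (suc k)) ⟨
      + valuation p (a ^ suc k) ℤ.+ -[1+ k ] ℤ.* l   ∎
  }
  where open ≡-Reasoning

-- Stated for `applyUpTo g` because the induction replaces g by `g ∘ suc`; `upTo` is the case g =
-- id.
hasValuations-product : ∀ {f : ℕ → ℚ} {v : ℕ → ℕ → ℤ} → (∀ k → HasValuations (f k) (v k)) →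
  {P : Pred ℕ 0ℓ} (P? : Decidable P) (g : ℕ → ℕ) (n : ℕ) →
  HasValuations (foldr ℚ._*_ 1ℚ (map f (filter P? (applyUpTo g n))))
                (λ p → ∑< n (λ k → if does (P? (g k)) then v (g k) p else 0ℤ))
hasValuations-product h P? g zero    = hasValuations-1
hasValuations-product h P? g (suc n) with does (P? (g 0))
... | true  = hasValuations-* (h (g 0)) (hasValuations-product h P? (g ∘ suc) n)
... | false = hasValuations-cong (λ _ → sym (ℤ.+-identityˡ _)) (hasValuations-product h P? (g ∘ suc) n)

∑<-1 : ∀ n → ∑< n (λ _ → 1ℤ) ≡ + n
∑<-1 zero    = refl
∑<-1 (suc n) = cong (λ i → 1ℤ ℤ.+ i) (∑<-1 n)

∑<-single : ∀ {n j} f → j < n → (∀ k → k ≢ j → f k ≡ 0ℤ) → ∑< n f ≡ f j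
∑<-single {suc n} {zero}  f _   f≗0 =
    trans (cong (λ i → f 0 ℤ.+ i) (∑<-zero n λ k _ → f≗0 (suc k) λ ())) (ℤ.+-identityʳ (f 0))
∑<-single {suc n} {suc j} f j<n f≗0 = trans (cong (λ i → i ℤ.+ ∑< n (f ∘ suc)) (f≗0 0 λ ()))
  (trans (ℤ.+-identityˡ _) (∑<-single (f ∘ suc) (s<s⁻¹ j<n) λ k k≢j → f≗0 (suc k) (k≢j ∘ suc-injective)))

∑<-nonNeg : ∀ n f → (∀ k → ∃[ c ] f k ≡ + c) → ∃[ c ] ∑< n f ≡ + c
∑<-nonNeg zero    f f≥0 = 0 , refl
∑<-nonNeg (suc n) f f≥0 with f≥0 0 | ∑<-nonNeg n (f ∘ suc) (f≥0 ∘ suc)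
... | c , f≡c | d , ∑≡d = c + d , cong₂ ℤ._+_ f≡c ∑≡d

-- The free upper bound n allows one common range of exponents for all F_d with d ≤ n, as the
-- exchange of summations requires.
valuation≡∑ : ∀ p .{{_ : NonTrivial p}} m .{{_ : NonZero m}} {n} → m ≤ n →
              + valuation p m ≡ ∑< n (λ j → χ (p ^ suc j ∣? m))
valuation≡∑ p m {n} m≤n = begin
  + v                                    ≡⟨ ∑<-1 v ⟨
  ∑< v (λ _ → 1ℤ)
    ≡⟨ ∑<-cong v (λ j j<v → sym (χ-true (p ^ suc j ∣? m) (k≤v⇒p^k∣m p m j<v))) ⟩
  ∑< v (λ j → χ (p ^ suc j ∣? m))
    ≡⟨ ∑<-truncate (λ j → χ (p ^ suc j ∣? m)) (≤-trans (<⇒≤ (<-≤-trans (k<p^k p v) (∣⇒≤ (p^v∣m p m)))) m≤n)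
                                             (λ j v≤j → χ-false (p ^ suc j ∣? m) λ d → <⇒≱ (p^k∣m⇒k≤v p m d) v≤j) ⟨
  ∑< n (λ j → χ (p ^ suc j ∣? m))        ∎
  where
  open ≡-Reasoning
  v = valuation p m

fib≢0 : ∀ n .{{_ : NonZero n}} → NonZero (fib n)
fib≢0 (suc n) = fib-nonZero n

-- Index j stands for the exponent j + 1. The cutoff F_n suffices, since p^{j+1} ∣ F_d with 1 ≤ d ≤
-- n forces j < F_n.
möbiusDual-valuation : ℕ → ℕ → ℤ
möbiusDual-valuation n p = ∑< (fib n) (λ j → dualCount n (p ^ suc j))

möbiusDual-hasValuations : ∀ n → HasValuations (möbiusDual n) (möbiusDual-valuation n)
möbiusDual-hasValuations n = hasValuations-cong eq
  (hasValuations-product (λ k → hasValuations-^ (fib (suc k)) {{fib-nonZero k}} (μ (n / suc k))) (λ k → suc k ∣? n) id n)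
  where
  open ≡-Reasoning
  N = fib n
  eq : ∀ {p} → Prime p →
    ∑< n (λ k → if does (suc k ∣? n) then μ (n / suc k) ℤ.* + valuation p (fib (suc k)) else 0ℤ) ≡ möbiusDual-valuation n p
  eq {p} pp = begin
    ∑< n (λ k → if does (suc k ∣? n) then μ (n / suc k) ℤ.* + valuation p (fib (suc k)) else 0ℤ)
      ≡⟨ ∑<-cong n (λ k _ → float k) ⟩
    ∑< n (λ k → weight n (suc k) ℤ.* + valuation p (fib (suc k)))
      -- Inserts the term d = 0, which has weight 0.
      ≡⟨ ℤ.+-identityˡ _ ⟨
    ∑< (suc n) (λ d → weight n d ℤ.* + valuation p (fib d))
      ≡⟨ ∑<-cong (suc n) (λ d d<1+n → expand d (s≤s⁻¹ d<1+n)) ⟩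
    ∑< (suc n) (λ d → ∑< N (λ j → weight n d ℤ.* χ (p ^ suc j ∣? fib d)))
      ≡⟨ ∑-comm {suc n} {N} (λ d j → weight n (toℕ d) ℤ.* χ (p ^ suc (toℕ j) ∣? fib (toℕ d))) ⟩
    möbiusDual-valuation n p ∎
    where
    instance _ = prime⇒nonTrivial pp
    float : ∀ k → (if does (suc k ∣? n) then μ (n / suc k) ℤ.* + valuation p (fib (suc k)) else 0ℤ)
                  ≡ weight n (suc k) ℤ.* + valuation p (fib (suc k))
    float k with does (suc k ∣? n)
    ... | true  = refl
    ... | false = refl
    expand : ∀ d → d ≤ n → weight n d ℤ.* + valuation p (fib d) ≡ ∑< N (λ j → weight n d ℤ.* χ (p ^ suc j ∣? fib d))
    expand zero      _   = sym (∑<-zero N λ _ _ → refl)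
    expand d@(suc k) d≤n =
        trans (cong (weight n d ℤ.*_) (valuation≡∑ p (fib d) {{fib-nonZero k}} (fib-mono-≤ d≤n)))
      (*-distribˡ-sum {N} (weight n d) (λ j → χ (p ^ suc (toℕ j) ∣? fib d)))

isEntryPoint? : ∀ t n .{{_ : NonZero n}} → Dec (IsEntryPoint t n)
isEntryPoint? t n with t ∣? fib n
... | no t∤fn = no (t∤fn ∘ IsEntryPoint.divides)
... | yes t∣fn with entry-exists n (>-nonZero⁻¹ n) t∣fn
...   | z , _ , entry with z ≟ n
...     | yes refl = yes entry
...     | no  z≢n  = no (z≢n ∘ isEntryPoint-unique entry)

dualCount-nonNeg : ∀ n .{{_ : NonZero n}} t → ∃[ c ] dualCount n t ≡ + c
dualCount-nonNeg n t with isEntryPoint? t n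
... | yes entry = 1 , dualCount-entry entry
... | no ¬entry = 0 , dualCount-¬entry (>-nonZero⁻¹ n) ¬entry

module _ {n} .{{_ : NonZero n}} {p} (exact : ∀ j → IsEntryPoint (p ^ suc j) n → ¬ (p ^ suc (suc j) ∣ fib n)) where

  -- At most one summand is 1: if n were the entry point of two powers of p, the larger power would
  -- divide F_n, against exactness at the smaller.
  möbiusDual-valuation≤1 : ∃[ c ] (c ≤ 1 × möbiusDual-valuation n p ≡ + c)
  möbiusDual-valuation≤1 with anyUpTo? (λ j → isEntryPoint? (p ^ suc j) n) (fib n)
  ... | no none =
      0 , z≤n , ∑<-zero (fib n) λ j j<N → dualCount-¬entry (>-nonZero⁻¹ n) λ entry → none (j , j<N , entry)
  ... | yes (j , j<N , entry) = 1 , s≤s z≤n ,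
          trans (∑<-single (λ j → dualCount n (p ^ suc j)) j<N others) (dualCount-entry entry)
    where
    too-high : ∀ {i k} → i < k → IsEntryPoint (p ^ suc i) n → ¬ IsEntryPoint (p ^ suc k) n
    too-high {i} i<k e f = exact i e (∣-trans (m≤n⇒p^m∣p^n p (s≤s i<k)) (IsEntryPoint.divides f))
    others : ∀ k → k ≢ j → dualCount n (p ^ suc k) ≡ 0ℤ
    others k k≢j = dualCount-¬entry (>-nonZero⁻¹ n) not-entry
      where
      not-entry : ¬ IsEntryPoint (p ^ suc k) n
      not-entry entry′ with <-cmp k j
      ... | tri< k<j _ _ = too-high k<j entry′ entry
      ... | tri≈ _ k≡j _ = k≢j k≡j
      ... | tri> _ _ j<k = too-high j<k entry entry′

-- Squarefreeness and the two implications

v≤1⇒squarefree : ∀ n .{{_ : NonZero n}} → (∀ {p} → Prime p → valuation p n ≤ 1) → Squarefree (+ n)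
v≤1⇒squarefree n v≤1 d d²∣n = unit ∣ d ∣ (subst (_∣ n) (ℤ.abs-* d d) d²∣n)
  where
  unit : ∀ d → d * d ∣ n → d ≡ 1
  unit 0 0∣n = contradiction (0∣⇒≡0 0∣n) (≢-nonZero⁻¹ n)
  unit 1 _   = refl
  unit d@(2+ _) d²∣n = case (∃-prime-divisor d (s≤s (s≤s z≤n)))
    where
    case : ∃[ p ] (Prime p × p ∣ d) → d ≡ 1
    case (p , pp , p∣d) = contradiction (v≤1 pp) (<⇒≱ (p^k∣m⇒k≤v p {{prime⇒nonTrivial pp}} {2} n
      (subst (_∣ n) (cong (p *_) (sym (*-identityʳ p))) (∣-trans (*-pres-∣ p∣d p∣d) d²∣n))))

module _ (noWSS : ¬ (∃[ p ] WallSunSun p)) where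

  exact-one : ∀ {p} → Prime p → ExactAt p 1
  exact-one {p} pp n entry p²∣fn =
      noWSS (p , pp , n , subst (λ t → IsEntryPoint t n) (*-identityʳ p) entry , p^k∣m⇒k≤v p (fib n) p²∣fn)
    where
    instance
      _ = prime⇒nonTrivial pp
      _ = fib≢0 n {{>-nonZero (IsEntryPoint.positive entry)}}

  exact-all : ∀ {p n} → Prime p → n ≢ 6 → ∀ j → IsEntryPoint (p ^ suc j) n → ¬ (p ^ suc (suc j) ∣ fib n)
  exact-all {p} pp n≢6 j entry with p ≟ 2
  ... | yes refl = exact-two j n≢6 entry
  ... | no  p≢2  = exact-odd pp p≢2 (exact-one pp) j _ entry

  noWSS⇒squarefree : ∀ n → 1 ≤ n → n ≢ 6 → IsSquarefreeInteger (möbiusDual n)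
  noWSS⇒squarefree n 1≤n n≢6 = + r , q≡r , v≤1⇒squarefree r v[r]≤1
    where
    instance n≢0 = >-nonZero 1≤n
    open HasValuations (möbiusDual-hasValuations n)
    instance
      num-nonZero = num≢0
      den-nonZero = den≢0
    bound : ∀ {p} → Prime p → ∃[ c ] (c ≤ 1 × möbiusDual-valuation n p ≡ + c)
    bound {p} pp = möbiusDual-valuation≤1 {n} {p} (exact-all pp n≢6)
    v-num : ∀ {p} (pp : Prime p) → valuation p num ≡ valuation p den + proj₁ (bound pp)
    v-num {p} pp =
        ℤ.+-injective (trans (valuation-num pp) (cong (λ i → + valuation p den ℤ.+ i) (proj₂ (proj₂ (bound pp)))))
    -- Integrality of M_n: its valuation is nonnegative at every prime.
    den∣num : den ∣ num
    den∣num =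
        v≤v⇒∣ den num λ p pp → subst (valuation p den ≤_) (sym (v-num pp)) (m≤m+n (valuation p den) (proj₁ (bound pp)))
    r = quotient den∣num
    num≡r*den : num ≡ r * den
    num≡r*den = m∣n⇒n≡quotient*m den∣num
    instance
      r≢0 = quotient≢0 den∣num
    q≡r : möbiusDual n ≡ + r ℚ./ 1
    q≡r =
        trans (fromℤ-cancelʳ den (trans q*den≡num (trans (cong (fromℤ ∘ +_) num≡r*den) (fromℤ-pos-* r den)))) (sym (/1≡fromℤ (+ r)))
    v[r]≤1 : ∀ {p} → Prime p → valuation p r ≤ 1
    v[r]≤1 {p} pp = ≤-trans (≤-reflexive (+-cancelʳ-≡ (valuation p den) (valuation p r) _ (begin
      valuation p r + valuation p den       ≡⟨ v[m*n] pp r den ⟨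
      valuation p (r * den)                 ≡⟨ cong (valuation p) num≡r*den ⟨
      valuation p num                       ≡⟨ v-num pp ⟩
      valuation p den + proj₁ (bound pp)    ≡⟨ +-comm (valuation p den) _ ⟩
      proj₁ (bound pp) + valuation p den    ∎))) (proj₁ (proj₂ (bound pp)))
      where open ≡-Reasoning

squarefree⇒noWSS : (∀ n → 1 ≤ n → n ≢ 6 → IsSquarefreeInteger (möbiusDual n)) → ¬ (∃[ p ] WallSunSun p)
squarefree⇒noWSS sqfree (p , pp , z , entry , 1<v) = nonTrivial⇒≢1 {p} (proj₂ (proj₂ integer) (+ p) p²∣m)
  where
  open IsEntryPoint entry renaming (divides to p∣fz)
  open ≡-Reasoning
  instance
    _ = prime⇒nonTrivial pp
    _ = prime⇒nonZero pp
    _ = >-nonZero positive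
    _ = fib≢0 z
  p²∣fz : p ^ 2 ∣ fib z
  p²∣fz = k≤v⇒p^k∣m p (fib z) 1<v
  -- F_6 = 2³ would force p ∣ 2 = F_3, so the entry point would be at most 3.
  z≢6 : z ≢ 6
  z≢6 refl = 1+n≰n {5} (≤-trans (minimal 3 (s≤s z≤n) p∣2) (s≤s (s≤s (s≤s z≤n))))
    where
    p∣2 : p ∣ fib 3
    p∣2 = prime∣m^k⇒prime∣m pp 2 3 p∣fz
  entry[p] : IsEntryPoint (p ^ 1) z
  entry[p] = subst (λ t → IsEntryPoint t z) (sym (*-identityʳ p)) entry
  entry[p²] : IsEntryPoint (p ^ 2) z
  entry[p²] = record
    { positive = positive ; divides = p²∣fz
    ; minimal = λ k 1≤k p²∣fk → minimal k 1≤k (p^1+j∣d⇒p∣d {p} {1} p²∣fk) }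
  f : ℕ → ℤ
  f j = dualCount z (p ^ suc j)
  -- The exponents 1 and 2 each contribute 1, and the other terms are nonnegative.
  v≥2 : ∀ n → 2 ≤ n → ∃[ c ] ∑< n f ≡ + (2 + c)
  v≥2 (suc zero)    (s≤s ())
  v≥2 (suc (suc n)) _ with ∑<-nonNeg n (f ∘ suc ∘ suc) (λ j → dualCount-nonNeg z (p ^ suc (suc (suc j))))
  ... | c , ∑≡c = c , cong₂ ℤ._+_ (dualCount-entry entry[p]) (cong₂ ℤ._+_ (dualCount-entry entry[p²]) ∑≡c)
  -- The range reaches both exponents because 2 < p² ≤ F_z.
  excess = v≥2 (fib z) (≤-trans (<⇒≤ (k<p^k p 2)) (∣⇒≤ p²∣fz))
  integer = sqfree z positive z≢6
  m = proj₁ integer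
  open HasValuations (möbiusDual-hasValuations z)
  instance den-nonZero = den≢0
  -- The integer m comes with no sign information, so absolute values bring the equation back to
  -- naturals.
  m*den≡num : ∣ m ∣ * den ≡ num
  m*den≡num = trans (sym (ℤ.abs-* m (+ den))) (cong ∣_∣ (fromℤ-injective (begin
    fromℤ (m ℤ.* + den)             ≡⟨ fromℤ-* m (+ den) ⟨
    fromℤ m ℚ.* fromℤ (+ den)
      ≡⟨ cong (ℚ._* fromℤ (+ den)) (trans (proj₁ (proj₂ integer)) (/1≡fromℤ m)) ⟨
    möbiusDual z ℚ.* fromℤ (+ den)  ≡⟨ q*den≡num ⟩
    fromℤ (+ num)                   ∎)))
  instance
    _ = m*n≢0⇒m≢0 ∣ m ∣ {den} {{subst NonZero (sym m*den≡num) num≢0}}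
  v[m] : valuation p ∣ m ∣ ≡ 2 + proj₁ excess
  v[m] = +-cancelʳ-≡ (valuation p den) (valuation p ∣ m ∣) (2 + proj₁ excess) (begin
    valuation p ∣ m ∣ + valuation p den     ≡⟨ v[m*n] pp ∣ m ∣ den ⟨
    valuation p (∣ m ∣ * den)               ≡⟨ cong (valuation p) m*den≡num ⟩
    valuation p num
      ≡⟨ ℤ.+-injective (trans (valuation-num pp) (cong (λ i → + valuation p den ℤ.+ i) (proj₂ excess))) ⟩
    valuation p den + (2 + proj₁ excess)    ≡⟨ +-comm (valuation p den) _ ⟩
    2 + proj₁ excess + valuation p den      ∎)
  p²∣m : (+ p ℤ.* + p) ℤ.∣ m
  p²∣m = subst (_∣ ∣ m ∣) (trans (cong (p *_) (*-identityʳ p)) (sym (ℤ.abs-* (+ p) (+ p))))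
    (k≤v⇒p^k∣m p {2} ∣ m ∣ (subst (2 ≤_) (sym v[m]) (m≤m+n 2 (proj₁ excess))))

corollary5p1 : (¬ (∃[ p ] WallSunSun p)) ⇔ ((n : ℕ) → 1 ≤ n → n ≢ 6 → IsSquarefreeInteger (möbiusDual n))
corollary5p1 = mk⇔ noWSS⇒squarefree squarefree⇒noWSS
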